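{- Let $P$ be a dcpo such that $\sigma(P\times P)=\sigma(P)\times\sigma(P)$. Then the Scott space $\Sigma P$ is sober if and only if \[ \mathord{\downarrow}(\mathord{\uparrow}x\cap A)\in\Gamma(P)\quad\text{for every } A\in\operatorname{Irr}_c(\Sigma P)\text{ and every } x\in P. \]
   Context: All posets and directed sets are nonempty. A subset $D$ of a poset is directed if any two of its elements have a common upper bound in $D$. A dcpo is a poset in which every directed subset has a supremum. Write $\mathord{\downarrow}x=\{y:y\le x\}$, $\mathord{\uparrow}x=\{y:x\le y\}$, and $\mathord{\downarrow}A=\bigcup_{a\in A}\mathord{\downarrow}a$ (so $\mathord{\downarrow}\emptyset=\emptyset$). For a dcpo $P$, an upper set $U\subseteq P$ is Scott open if for every directed $D\subseteq P$, $\bigvee D\in U$ implies $D\cap U\neq\emptyset$; the Scott open sets form the Scott topology $\sigma(P)$, and $\Sigma P=(P,\sigma(P))$ is the Scott space. $\Gamma(P)$ is the collection of Scott-closed subsets of $P$ (including $\emptyset$), i.e. the lower sets closed under directed suprema. A nonempty Scott-closed set $A$ is irreducible if any two open sets meeting $A$ have an intersection meeting $A$; $\operatorname{Irr}_c(\Sigma P)$ is the set of irreducible Scott-closed sets. $\Sigma P$ is sober if each $A\in\operatorname{Irr}_c(\Sigma P)$ equals $\mathord{\downarrow}a$ for a unique $a\in P$. $\sigma(P\times P)$ is the Scott topology of the coordinatewise order on $P\times P$, and $\sigma(P)\times\sigma(P)$ denotes the ordinary product topology. -}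

module Defs where

open import Data.Product using (∃; ∃!; _×_; _,_)
open import Level using (Level; suc)
open import Relation.Binary.Bundles using (Poset)
open import Relation.Unary using (Pred; _∈_; _⊆_; _≐_; _≬_; _∩_; _⟨×⟩_; Satisfiable)

-- Subsets of a poset are predicates at the poset's own level, so that every
-- set built below by order comprehension is again such a subset.  They need not
-- respect the poset's _≈_; open, closed and lower sets do so automatically.

module _ {ℓ : Level} (P : Poset ℓ ℓ ℓ) where
  open Poset P

  Subset : Set (suc ℓ)
  Subset = Pred Carrier ℓ

  ↑ : Carrier → Subset
  ↑ x y = x ≤ y

  ↓ : Carrier → Subset
  ↓ x y = y ≤ x

  ↓ˢ : Subset → Subset
  ↓ˢ A y = ∃ λ a → a ∈ A × y ∈ ↓ a

  IsUpper : Pred Subset ℓ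
  IsUpper U = ∀ {x y} → x ≤ y → x ∈ U → y ∈ U

  IsLower : Pred Subset ℓ
  IsLower A = ∀ {x y} → x ≤ y → y ∈ A → x ∈ A

  IsDirected : Pred Subset ℓ
  IsDirected D =
    Satisfiable D ×
    (∀ {x y} → x ∈ D → y ∈ D → ∃ λ z → z ∈ D × x ≤ z × y ≤ z)

  IsSup : Subset → Carrier → Set ℓ
  IsSup D s =
    (∀ {d} → d ∈ D → d ≤ s) ×
    (∀ {u} → (∀ {d} → d ∈ D → d ≤ u) → s ≤ u)

  IsDcpo : Set (suc ℓ)
  IsDcpo = ∀ (D : Subset) → IsDirected D → ∃ (IsSup D)

  -- Suprema are unique up to _≈_, so quantifying over all suprema s of D is the
  -- same as speaking about ⋁ D.
  σ : Pred Subset (suc ℓ)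
  σ U =
    IsUpper U ×
    (∀ (D : Subset) → IsDirected D → ∀ {s} → IsSup D s → s ∈ U → D ≬ U)

  Γ : Pred Subset (suc ℓ)
  Γ A =
    IsLower A ×
    (∀ (D : Subset) → IsDirected D → D ⊆ A → ∀ {s} → IsSup D s → s ∈ A)

  Irrᶜ : Pred Subset (suc ℓ)
  Irrᶜ A =
    A ∈ Γ ×
    Satisfiable A ×
    (∀ (U V : Subset) → U ∈ σ → V ∈ σ → A ≬ U → A ≬ V → A ≬ (U ∩ V))

  IsSober : Set (suc ℓ)
  IsSober = ∀ (A : Subset) → A ∈ Irrᶜ → ∃! _≈_ (λ a → A ≐ ↓ a)

-- The product of two topologies, each given by its collection of open sets.
_⊗_ : ∀ {ℓ} {X Y : Set ℓ} →
      Pred (Pred X ℓ) (suc ℓ) → Pred (Pred Y ℓ) (suc ℓ) →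
      Pred (Pred (X × Y) ℓ) (suc ℓ)
_⊗_ {ℓ} {X} {Y} τ₁ τ₂ W =
  ∀ {x y} → (x , y) ∈ W →
  ∃ λ (U : Pred X ℓ) → ∃ λ (V : Pred Y ℓ) →
    U ∈ τ₁ × V ∈ τ₂ × (x , y) ∈ (U ⟨×⟩ V) × (U ⟨×⟩ V) ⊆ W

{-# OPTIONS --safe #-}
-- For irreducible closed A, closedness of each ↓(↑x ∩ A) makes separately, hence
-- jointly, Scott closed the relation "x and y have a common upper bound in A".
-- Were its complement W to contain some (x , y) with x, y ∈ A, it would contain an
-- open box U × V around it, since W is open in the product topology; irreducibility
-- then puts some a ∈ A in U ∩ V, although a bounds (a , a) in A.  So A is directed,
-- and A = ↓(⋁ A).
module Submission where

open import Defs
open import Axiom.ExcludedMiddle using (ExcludedMiddle)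
open import Axiom.DoubleNegationElimination using (em⇒dne)
open import Data.Product using (∃; _×_; _,_; proj₁; proj₂)
open import Data.Product.Relation.Binary.Pointwise.NonDependent using (×-poset)
open import Function.Base using (_∘_)
open import Function.Bundles using (_⇔_; mk⇔)
open import Level using (Level)
open import Relation.Binary.Bundles using (Poset)
open import Relation.Unary using (_∈_; _∩_; _≐_; ∁)

-- A directed set that misses `∁ A` lies in `A` by double negation elimination, and then so does its
-- supremum.
∁-open : ∀ {ℓ} → ExcludedMiddle ℓ → (P : Poset ℓ ℓ ℓ) →
  ∀ {A : Subset P} → A ∈ Γ P → ∁ A ∈ σ P
∁-open em P (lower , closed) =
  (λ x≤y x∉A y∈A → x∉A (lower x≤y y∈A)) ,
  (λ D dir sup s∉A → em⇒dne em λ D∩∁A=∅ →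
    s∉A (closed D dir (λ d∈D → em⇒dne em λ d∉A → D∩∁A=∅ (_ , d∈D , d∉A)) sup))

module _ {ℓ : Level} (P : Poset ℓ ℓ ℓ) where
  open Poset P
  private P² = ×-poset P P

  image₁ image₂ : Subset P² → Subset P
  image₁ D x = ∃ λ y → D (x , y)
  image₂ D y = ∃ λ x → D (x , y)

  image₁-directed : ∀ {D} → IsDirected P² D → IsDirected P (image₁ D)
  image₁-directed ((_ , d∈D) , bound) = (_ , _ , d∈D) , λ (_ , p) (_ , q) →
    let _ , r , (x≤z , _) , (y≤z , _) = bound p q in _ , (_ , r) , x≤z , y≤z

  image₂-directed : ∀ {D} → IsDirected P² D → IsDirected P (image₂ D)
  image₂-directed ((_ , d∈D) , bound) = (_ , _ , d∈D) , λ (_ , p) (_ , q) →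
    let _ , r , (_ , x≤z) , (_ , y≤z) = bound p q in _ , (_ , r) , x≤z , y≤z

  -- If `u` bounds the first projection of `D`, then `(u , t)` bounds `D`, so leastness of `(s , t)`
  -- gives `s ≤ u`.
  image₁-sup : ∀ {D s t} → IsSup P² D (s , t) → IsSup P (image₁ D) s
  image₁-sup (upper , least) =
    (λ (_ , p) → proj₁ (upper p)) ,
    (λ ub → proj₁ (least λ p → ub (_ , p) , proj₂ (upper p)))

  image₂-sup : ∀ {D s t} → IsSup P² D (s , t) → IsSup P (image₂ D) t
  image₂-sup (upper , least) =
    (λ (_ , p) → proj₂ (upper p)) ,
    (λ ub → proj₂ (least λ p → proj₁ (upper p) , ub (_ , p)))

  -- Suprema are taken one coordinate at a time: with `x` in the first projection fixed, first
  -- `(x , t)` and then `(s , t)` is in `C`.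
  separately-closed⇒closed : ∀ {C : Subset P²} →
    (∀ x → (λ y → C (x , y)) ∈ Γ P) → (∀ y → (λ x → C (x , y)) ∈ Γ P) → C ∈ Γ P²
  separately-closed⇒closed {C} closedʳ closedˡ =
    (λ (x≤x′ , y≤y′) → proj₁ (closedˡ _) x≤x′ ∘ proj₁ (closedʳ _) y≤y′) ,
    λ D dir D⊆C sup →
      proj₂ (closedˡ _) (image₁ D) (image₁-directed dir)
        (λ (_ , p) → proj₂ (closedʳ _) (image₂ D) (image₂-directed dir)
          (λ (_ , q) →
            -- The pair `(x , y)` need not be in `D`, but it lies below a member of `D`, and `C` is
            -- lower in each coordinate.
            let _ , r , (x≤z , _) , (_ , y≤z) = proj₂ dir p q
            in proj₁ (closedˡ _) x≤z (proj₁ (closedʳ _) y≤z (D⊆C r)))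
          (image₂-sup sup))
        (image₁-sup sup)

  -- In this form the section at `x` is literally the set assumed closed; the relation is
  -- nevertheless symmetric, so the sections in the other variable are closed too.
  BoundedIn : Subset P → Subset P²
  BoundedIn A (x , y) = ↓ˢ P (↑ P x ∩ A) y

  BoundedIn-sym : ∀ {A x y} → BoundedIn A (x , y) → BoundedIn A (y , x)
  BoundedIn-sym (a , (x≤a , a∈A) , y≤a) = a , (y≤a , a∈A) , x≤a

  BoundedIn-closed : ∀ {A} → (∀ x → ↓ˢ P (↑ P x ∩ A) ∈ Γ P) → BoundedIn A ∈ Γ P²
  BoundedIn-closed {A} closed = separately-closed⇒closed closed λ y →
    let lower , sups = closed y in
    (λ x≤x′ → BoundedIn-sym ∘ lower x≤x′ ∘ BoundedIn-sym) ,
    (λ D dir D⊆ sup → BoundedIn-sym (sups D dir (BoundedIn-sym ∘ D⊆) sup))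

  irreducible⇒directed : ExcludedMiddle ℓ → (∀ {W} → W ∈ σ P² → W ∈ (σ P ⊗ σ P)) →
    ∀ {A} → A ∈ Irrᶜ P → (∀ x → ↓ˢ P (↑ P x ∩ A) ∈ Γ P) → IsDirected P A
  irreducible⇒directed em σ⊆⊗ {A} (_ , nonempty , irr) closed =
    nonempty , λ x∈A y∈A →
      -- The open-box argument only refutes the absence of a bound; excluded middle supplies the
      -- bound itself.
      let a , (x≤a , a∈A) , y≤a = em⇒dne em (¬¬bounded x∈A y∈A) in a , a∈A , x≤a , y≤a
    where
    ¬¬bounded : ∀ {x y} → x ∈ A → y ∈ A → (x , y) ∈ ∁ (∁ (BoundedIn A))
    ¬¬bounded x∈A y∈A unbounded
      with U , V , U-open , V-open , (x∈U , y∈V) , U×V⊆W ←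
             σ⊆⊗ (∁-open em P² (BoundedIn-closed closed)) unbounded
      with a , a∈A , a∈U , a∈V ← irr U V U-open V-open (_ , x∈A , x∈U) (_ , y∈A , y∈V)
      = U×V⊆W (a∈U , a∈V) (a , (refl , a∈A) , refl)

  directed-closed⇒principal : IsDcpo P → ∀ {A} → A ∈ Γ P → IsDirected P A →
    ∃ λ a → A ≐ ↓ P a
  directed-closed⇒principal dcpo {A} (lower , closed) dir =
    let s , sup = dcpo A dir
    in s , proj₁ sup , λ x≤s → lower x≤s (closed A dir (λ p → p) sup)

  ≐↓-unique : ∀ {A : Subset P} {a b} → A ≐ ↓ P a → A ≐ ↓ P b → a ≈ b
  ≐↓-unique (A⊆↓a , ↓a⊆A) (A⊆↓b , ↓b⊆A) = antisym (A⊆↓b (↓a⊆A refl)) (A⊆↓a (↓b⊆A refl))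

  -- For `A = ↓ a` the set is `↓ a` when `x ≤ a` and empty otherwise. A member of the directed set
  -- `D` decides for the first case.
  principal⇒↓↑∩-closed : ∀ {A : Subset P} {a} → A ≐ ↓ P a → ∀ x → ↓ˢ P (↑ P x ∩ A) ∈ Γ P
  principal⇒↓↑∩-closed {a = a} (A⊆↓a , ↓a⊆A) x =
    (λ y≤z (b , b∈ , z≤b) → b , b∈ , trans y≤z z≤b) ,
    λ D ((_ , d∈D) , _) D⊆ sup →
      let _ , (x≤b , b∈A) , _ = D⊆ d∈D in
      a , (trans x≤b (A⊆↓a b∈A) , ↓a⊆A refl) ,
      proj₂ sup λ e∈D → let _ , (_ , c∈A) , e≤c = D⊆ e∈D in trans e≤c (A⊆↓a c∈A)

proposition5p2 : ∀ {ℓ} → ExcludedMiddle ℓ →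
    (P : Poset ℓ ℓ ℓ) → Poset.Carrier P → IsDcpo P →
    σ (×-poset P P) ≐ (σ P ⊗ σ P) →
    IsSober P ⇔ (∀ (A : Subset P) → A ∈ Irrᶜ P → ∀ (x : Poset.Carrier P) → ↓ˢ P (↑ P x ∩ A) ∈ Γ P)
proposition5p2 em P _ dcpo (σ⊆⊗ , _) = mk⇔
  (λ sober A irr → principal⇒↓↑∩-closed P (proj₁ (proj₂ (sober A irr))))
  (λ closed A irr →
    let a , A≐↓a = directed-closed⇒principal P dcpo (proj₁ irr)
                     (irreducible⇒directed P em σ⊆⊗ irr (closed A irr))
    in a , A≐↓a , λ {_} → ≐↓-unique P A≐↓a)
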